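{- Let $Q\ge 3$ be an integer and let $\mathscr{S}_Q^*:=\{0\}\cup\mathscr{S}_Q$, where $\mathscr{S}_Q$ is the set of $\operatorname{SL}(2,\mathbb{N})$-saturated Farey fractions of order $Q$. If $\gamma_1=a_1/q_1<\gamma_2=a_2/q_2$ (written in lowest terms with positive denominators, $0=0/1$) are consecutive elements of $\mathscr{S}_Q^*$, then $a_2q_1-a_1q_2=1$.
   Context: Let $\mathcal{S}$ be the set of matrices $\begin{pmatrix} a&b\\ c&d\end{pmatrix}\in\operatorname{SL}(2,\mathbb{Z})$ with $a\ge b\ge d\ge 1$ and $a\ge c\ge d$, and let $\mathcal{S}_Q=\{M\in\mathcal{S}:\operatorname{Tr}M\le Q\}$. The set of $\operatorname{SL}(2,\mathbb{N})$-saturated Farey fractions of order $Q$ is $\mathscr{S}_Q:=\left\{d/b:\begin{pmatrix} a&b\\ c&d\end{pmatrix}\in\mathcal{S}_Q\right\}\subset\mathbb{Q}\cap(0,1]$. -}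

module Defs where

open import Data.Integer.Base as ℤ using (ℤ; +_; 1ℤ; _≤_; _≥_; _*_; _-_; ∣_∣)
open import Data.Integer.Properties using (≤-trans; suc[i]≤j⇒i<j)
open import Data.Product.Base using (_×_; _,_; Σ-syntax; ∃-syntax)
open import Data.Rational.Base as ℚ using (ℚ; 0ℚ)
open import Level using (0ℓ)
open import Relation.Binary.PropositionalEquality.Core using (_≡_)
open import Relation.Nullary.Negation.Core using (¬_)
open import Relation.Unary using (Pred; _∈_; _∪_; ｛_｝)

-- The matrix with rows (a , b) and (c , d).
record SL₂ℤ : Set where
  constructor mkSL₂ℤ
  field
    a b c d : ℤ
    det≡1   : a * d - b * c ≡ 1ℤ

open SL₂ℤ public using (a; b; c; d; det≡1)

Tr : SL₂ℤ → ℤ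
Tr M = a M ℤ.+ d M

record 𝒮 (M : SL₂ℤ) : Set where
  constructor mk𝒮
  field
    a≥b : a M ≥ b M
    b≥d : b M ≥ d M
    d≥1 : d M ≥ 1ℤ
    a≥c : a M ≥ c M
    c≥d : c M ≥ d M

𝒮≤ : ℤ → Pred SL₂ℤ 0ℓ
𝒮≤ Q M = M ∈ 𝒮 × Tr M ≤ Q

b-nonZero : ∀ {M} → M ∈ 𝒮 → ℤ.NonZero (b M)
b-nonZero M∈𝒮 = ℤ.>-nonZero (suc[i]≤j⇒i<j (≤-trans d≥1 b≥d))
  where open 𝒮 M∈𝒮 using (b≥d; d≥1)

-- The library's division takes a natural-number denominator; since b ≥ 1
-- on 𝒮, replacing b by ∣ b ∣ does not change the quotient.
d/b : ∀ M → M ∈ 𝒮 → ℚ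
d/b M M∈𝒮 = (d M ℚ./ ∣ b M ∣) {{b-nonZero M∈𝒮}}

SaturatedFarey : ℤ → Pred ℚ 0ℓ
SaturatedFarey Q γ = ∃[ M ] Σ[ (M∈𝒮 , _) ∈ M ∈ 𝒮≤ Q ] γ ≡ d/b M M∈𝒮

SaturatedFarey* : ℤ → Pred ℚ 0ℓ
SaturatedFarey* Q = ｛ 0ℚ ｝ ∪ SaturatedFarey Q

record Consecutive (S : Pred ℚ 0ℓ) (γ₁ γ₂ : ℚ) : Set where
  constructor mkConsecutive
  field
    γ₁∈S            : γ₁ ∈ S
    γ₂∈S            : γ₂ ∈ S
    γ₁<γ₂           : γ₁ ℚ.< γ₂
    nothing-between : ∀ γ → γ ∈ S → ¬ (γ₁ ℚ.< γ × γ ℚ.< γ₂)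

{-# OPTIONS --safe #-}

-- If ed − bf = 1 with 1 ≤ d ≤ b and e + b + d ≤ Q, then the matrix
-- (e+b b; f+d d) exhibits d/b as an element of the saturated set, and every
-- element arises so, even with e ≤ b.  Hence the left Farey parent f/e of an
-- element d/b is 0 or again an element, and so is the right Farey parent
-- (d−f)/(b−e) when d/b < 1.  For consecutive γ₁ < γ₂ this puts the left parent
-- of γ₂ at or below γ₁, and the right parent of γ₁ at or above γ₂.  If both
-- inequalities were strict, each of γ₁, γ₂ would be a generalised mediant of
-- the other and one of those parents, and the numerators could not compare
-- consistently.  So one is an equality, and a fraction and its Farey parent
-- are unimodular.
module Submission where

open import Defs
open import Data.Integer.Base using (ℤ; +_; _≥_; _*_; _-_; 1ℤ)
open import Data.Rational.Base using (ℚ; ↥_; ↧_)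
open import Relation.Binary.PropositionalEquality.Core using (_≡_)

import Data.Integer.Base as ℤ
import Data.Integer.Properties as ℤ
open import Data.List.Base using ([]; _∷_)
open import Data.Nat.Base as ℕ using (ℕ; zero; suc; z≤n; s≤s; _+_; _≤_; _<_)
open import Data.Nat.Coprimality using (Coprime)
open import Data.Nat.Divisibility using (_∣_; ∣m+n∣m⇒∣n; ∣1⇒≡1; ∣m⇒∣m*n; ∣n⇒∣m*n; m∣m*n)
open import Data.Nat.DivMod using (_/_; _%_; m≡m%n+[m/n]*n; m%n<n)
import Data.Nat.Properties as ℕ
open import Data.Nat.Tactic.RingSolver using (solve)
open import Data.Product.Base using (_×_; _,_; ∃; ∃₂)
import Data.Rational.Base as ℚ
import Data.Rational.Properties as ℚ
open import Data.Sum.Base using (_⊎_; inj₁; inj₂)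
open import Relation.Binary.PropositionalEquality
  using (refl; sym; trans; cong; cong₂; subst; subst₂; module ≡-Reasoning)
open import Relation.Nullary.Negation using (contradiction)
open import Relation.Unary using (_∈_)

-- Determinant-one matrices over ℕ.

-- The rows are `(e , b)` and `(f , d)`. The negative term is moved to the right so that no
-- truncated subtraction occurs; the record wrapper lets the four entries be inferred.
record Det₁ (e b f d : ℕ) : Set where
  constructor mkDet₁
  field det : e ℕ.* d ≡ 1 + b ℕ.* f

open Det₁

det₁⇒coprime : ∀ {e b f d} → Det₁ e b f d → Coprime d b
det₁⇒coprime {e} {b} {f} {d} M {i} (i∣d , i∣b) =
  ∣1⇒≡1 (∣m+n∣m⇒∣n
    (subst (i ∣_) (trans (det M) (ℕ.+-comm 1 (b ℕ.* f))) (∣n⇒∣m*n e i∣d))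
    (∣m⇒∣m*n f i∣b))

det₁⇒< : ∀ {e b f d} → Det₁ e b f d → b ℕ.* f < e ℕ.* d
det₁⇒< M = ℕ.≤-reflexive (sym (det M))

det₁⇒e≥1 : ∀ {e b f d} → Det₁ e b f d → 1 ≤ e
det₁⇒e≥1 {zero}  (mkDet₁ ())
det₁⇒e≥1 {suc e} _ = s≤s z≤n

d≤b⇒f<e : ∀ {e b f d} → Det₁ e b f d → d ≤ b → f < e
d≤b⇒f<e {e} {b} {f} {d} M d≤b = ℕ.*-cancelˡ-< b f e (begin-strict
  b ℕ.* f  <⟨ det₁⇒< M ⟩
  e ℕ.* d  ≤⟨ ℕ.*-monoʳ-≤ e d≤b ⟩
  e ℕ.* b  ≡⟨ ℕ.*-comm e b ⟩
  b ℕ.* e  ∎)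
  where open ℕ.≤-Reasoning

e≤b⇒f<d : ∀ {e b f d} → Det₁ e b f d → e ≤ b → f < d
e≤b⇒f<d {e} {b} {f} {d} M e≤b = ℕ.*-cancelˡ-< b f d (begin-strict
  b ℕ.* f  <⟨ det₁⇒< M ⟩
  e ℕ.* d  ≤⟨ ℕ.*-monoˡ-≤ d e≤b ⟩
  b ℕ.* d  ∎)
  where open ℕ.≤-Reasoning

-- Subtracting a multiple of the column `(b , d)` from `(e , f)` preserves the determinant.
det₁-reduce : ∀ {e b f d} → 1 ≤ b → 1 ≤ d → Det₁ e b f d →
              ∃₂ λ e′ f′ → Det₁ e′ b f′ d × e′ ≤ e × e′ ≤ b
det₁-reduce {zero} _ _ (mkDet₁ ())
det₁-reduce {suc e} {b@(suc _)} {f} {d} _ 1≤d M =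
  suc r , g , mkDet₁ (ℕ.+-cancelʳ-≡ (b ℕ.* (q ℕ.* d)) _ _ eq′) , s≤s r≤e , m%n<n e b
  where
  -- Here `e` is the predecessor of the matrix entry, so the new entry `suc r` falls in 1, ..., `b`
  -- and never becomes 0.
  r = e % b
  q = e / b

  r≤e : r ≤ e
  r≤e = subst (r ≤_) (sym (m≡m%n+[m/n]*n e b)) (ℕ.m≤m+n r (q ℕ.* b))

  split : ∀ r q b → suc (r + q ℕ.* b) ℕ.* d ≡ suc r ℕ.* d + b ℕ.* (q ℕ.* d)
  split r q b = solve (r ∷ q ∷ b ∷ d ∷ [])

  eq : suc r ℕ.* d + b ℕ.* (q ℕ.* d) ≡ 1 + b ℕ.* f
  eq = trans (sym (split r q b))
         (trans (cong (λ z → suc z ℕ.* d) (sym (m≡m%n+[m/n]*n e b))) (det M))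

  -- This makes the truncated subtraction in `g` exact.
  qd≤f : q ℕ.* d ≤ f
  qd≤f = ℕ.*-cancelˡ-≤ b (ℕ.s≤s⁻¹ (begin
    1 + b ℕ.* (q ℕ.* d)            ≤⟨ ℕ.+-monoˡ-≤ _ (ℕ.*-mono-≤ {1} {suc r} (s≤s z≤n) 1≤d) ⟩
    suc r ℕ.* d + b ℕ.* (q ℕ.* d)  ≡⟨ eq ⟩
    1 + b ℕ.* f                    ∎))
    where open ℕ.≤-Reasoning

  g = f ℕ.∸ q ℕ.* d

  eq′ : suc r ℕ.* d + b ℕ.* (q ℕ.* d) ≡ 1 + b ℕ.* g + b ℕ.* (q ℕ.* d)
  eq′ = trans eq (cong suc (trans (cong (b ℕ.*_) (sym (ℕ.m∸n+n≡m qd≤f)))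
                                  (ℕ.*-distribˡ-+ b g (q ℕ.* d))))

-- Elements of the saturated set and their Farey parents.

-- For a matrix of `𝒮`, `e` and `f` stand for `a - b` and `c - d`. Being naturals, they encode
-- `a ≥ b` and `c ≥ d`; the trace becomes `e + b + d`.
record Member (Q : ℤ) (d b : ℕ) : Set where
  constructor mkMember
  field
    e f     : ℕ
    matrix  : Det₁ e b f d
    1≤d     : 1 ≤ d
    d≤b     : d ≤ b
    trace≤Q : + (e + b + d) ℤ.≤ Q

  1≤b : 1 ≤ b
  1≤b = ℕ.≤-trans 1≤d d≤b

member⇒coprime : ∀ {Q d b} → Member Q d b → Coprime d b
member⇒coprime m = det₁⇒coprime (Member.matrix m)

member-reduce : ∀ {Q d b} → Member Q d b → ∃ λ (m : Member Q d b) → Member.e m ≤ b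
member-reduce {Q} {d} {b} m with det₁-reduce 1≤b 1≤d matrix
  where open Member m
... | e′ , f′ , M′ , e′≤e , e′≤b =
  mkMember e′ f′ M′ 1≤d d≤b
    (ℤ.≤-trans (ℤ.+≤+ (ℕ.+-monoˡ-≤ d (ℕ.+-monoˡ-≤ b e′≤e))) trace≤Q) , e′≤b
  where open Member m

-- The new matrix entries are (1 + b) e − b and (1 + b) f − d, written
-- without subtraction.
det₁-left : ∀ {e b f d} → 1 ≤ f → d ≤ b → Det₁ e b f d → ∃₂ λ e′ f′ → Det₁ e′ e f′ f
det₁-left {zero} _ _ (mkDet₁ ())
det₁-left {suc e} {b} {suc f} {d} _ d≤b M with ℕ.m≤n⇒∃[o]m+o≡n d≤b
... | k , refl = 1 + suc b ℕ.* e , suc b ℕ.* f + suc k ,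
  mkDet₁ (ℕ.+-cancelʳ-≡ (1 + b ℕ.* suc f) _ _
    (trans (identity e f d k) (cong (1 + suc e ℕ.* (suc (d + k) ℕ.* f + suc k) ℕ.+_) (det M))))
  where
  identity : ∀ e f d k →
    (1 + suc (d + k) ℕ.* e) ℕ.* suc f + (1 + (d + k) ℕ.* suc f)
    ≡ 1 + suc e ℕ.* (suc (d + k) ℕ.* f + suc k) + suc e ℕ.* d
  identity e f d k = solve (e ∷ f ∷ d ∷ k ∷ [])

-- In a reduced matrix, the left column is the parent. A reduced completion of that column has trace
-- at most `e + e + f`, and `e ≤ b` and `f < d` bound this by the old trace.
left-parent : ∀ {Q d b} → Member Q d b →
              ∃₂ λ e f → Det₁ e b f d × (f ≡ 0 ⊎ Member Q f e)
left-parent m with member-reduce m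
... | mkMember e zero M _ _ _ , _ = e , 0 , M , inj₁ refl
... | mkMember e f@(suc _) M 1≤d d≤b tr , e≤b
  with e′ , f′ , M′ ← det₁-left (s≤s z≤n) d≤b M
  with e″ , f″ , M″ , _ , e″≤e ← det₁-reduce (det₁⇒e≥1 M) (s≤s z≤n) M′ =
  e , f , M , inj₂ (mkMember e″ f″ M″ (s≤s z≤n) (ℕ.<⇒≤ (d≤b⇒f<e M d≤b))
    (ℤ.≤-trans (ℤ.+≤+ (ℕ.+-mono-≤ (ℕ.+-mono-≤ e″≤e e≤b) (ℕ.<⇒≤ (e≤b⇒f<d M e≤b)))) tr))

-- Once `e ≤ b`, subtracting the left column of the matrix from the right one gives `(q , p)`. The
-- same `e` and `f` witness membership, and the trace does not grow.
right-parent : ∀ {Q d b} → Member Q d b → d < b →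
               ∃₂ λ p q → Det₁ b q d p × Member Q p q
right-parent {Q} {d} {b} m d<b with member-reduce m
... | mkMember e f M 1≤d d≤b tr , e≤b
  with p , refl ← ℕ.m≤n⇒∃[o]m+o≡n (ℕ.<⇒≤ (e≤b⇒f<d M e≤b))
  with q , refl ← ℕ.m≤n⇒∃[o]m+o≡n e≤b =
  p , q , M₁ , mkMember e f M₂ 1≤p (p≤q q M₁ d<b)
    (ℤ.≤-trans (ℤ.+≤+ (ℕ.+-mono-≤ (ℕ.+-monoʳ-≤ e (ℕ.m≤n+m q e)) (ℕ.m≤n+m p f))) tr)
  where
  1≤p : 1 ≤ p
  1≤p = ℕ.+-cancelˡ-< f 0 p (subst (_< f + p) (sym (ℕ.+-identityʳ f)) (e≤b⇒f<d M e≤b))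

  M₂ : Det₁ e q f p
  M₂ = mkDet₁ (ℕ.+-cancelˡ-≡ (e ℕ.* f) _ _ (begin
    e ℕ.* f + e ℕ.* p          ≡⟨ ℕ.*-distribˡ-+ e f p ⟨
    e ℕ.* (f + p)              ≡⟨ det M ⟩
    1 + (e + q) ℕ.* f          ≡⟨ solve (e ∷ q ∷ f ∷ []) ⟩
    e ℕ.* f + (1 + q ℕ.* f)    ∎))
    where open ≡-Reasoning

  M₁ : Det₁ (e + q) q (f + p) p
  M₁ = mkDet₁ (begin
    (e + q) ℕ.* p              ≡⟨ ℕ.*-distribʳ-+ p e q ⟩
    e ℕ.* p + q ℕ.* p          ≡⟨ cong (_+ q ℕ.* p) (det M₂) ⟩
    1 + q ℕ.* f + q ℕ.* p      ≡⟨ solve (q ∷ f ∷ p ∷ []) ⟩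
    1 + q ℕ.* (f + p)          ∎)
    where open ≡-Reasoning

  p≤q : ∀ {b} q → Det₁ b q d p → d < b → p ≤ q
  -- `q` = 0 would give `b` = 1, against 1 ≤ `d` < `b`.
  p≤q {b} zero M₀ d<b with refl ← ℕ.m*n≡1⇒m≡1 b p (det M₀) =
    contradiction d<b (ℕ.≤⇒≯ 1≤d)
  p≤q {b@(suc _)} q@(suc q₀) M₀ d<b = ℕ.*-cancelˡ-≤ b (begin
    b ℕ.* p          ≡⟨ det M₀ ⟩
    1 + q ℕ.* d      ≤⟨ ℕ.+-monoˡ-≤ (q ℕ.* d) (s≤s (z≤n {q₀})) ⟩
    q + q ℕ.* d      ≡⟨ ℕ.*-suc q d ⟨
    q ℕ.* suc d      ≤⟨ ℕ.*-monoʳ-≤ q d<b ⟩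
    q ℕ.* b          ≡⟨ ℕ.*-comm q b ⟩
    b ℕ.* q          ∎)
    where open ℕ.≤-Reasoning

-- The unimodularity argument.

-- Cramer's rule, for the vector (d₁ , b₁) in the basis (d₂ , b₂), (f , e).
cramer : ∀ {d₁ b₁ d₂ b₂ e f x D} → Det₁ e b₂ f d₂ →
         d₁ ℕ.* e ≡ f ℕ.* b₁ + x → d₂ ℕ.* b₁ ≡ d₁ ℕ.* b₂ + D →
         d₁ ≡ x ℕ.* d₂ + D ℕ.* f × b₁ ≡ x ℕ.* b₂ + D ℕ.* e
cramer {d₁} {b₁} {d₂} {b₂} {e} {f} {x} {D} M eqx eqD =
  ℕ.+-cancelʳ-≡ (b₂ ℕ.* f ℕ.* d₁) _ _ (begin
    d₁ + b₂ ℕ.* f ℕ.* d₁                      ≡⟨⟩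
    (1 + b₂ ℕ.* f) ℕ.* d₁                     ≡⟨ cong (ℕ._* d₁) (det M) ⟨
    e ℕ.* d₂ ℕ.* d₁                           ≡⟨ solve (e ∷ d₁ ∷ d₂ ∷ []) ⟩
    d₂ ℕ.* (d₁ ℕ.* e)                         ≡⟨ cong (d₂ ℕ.*_) eqx ⟩
    d₂ ℕ.* (f ℕ.* b₁ + x)                     ≡⟨ solve (d₂ ∷ b₁ ∷ f ∷ x ∷ []) ⟩
    x ℕ.* d₂ + f ℕ.* (d₂ ℕ.* b₁)              ≡⟨ cong (λ z → x ℕ.* d₂ + f ℕ.* z) eqD ⟩
    x ℕ.* d₂ + f ℕ.* (d₁ ℕ.* b₂ + D)          ≡⟨ solve (d₁ ∷ d₂ ∷ b₂ ∷ f ∷ x ∷ D ∷ []) ⟩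
    x ℕ.* d₂ + D ℕ.* f + b₂ ℕ.* f ℕ.* d₁      ∎) ,
  ℕ.+-cancelʳ-≡ (b₂ ℕ.* f ℕ.* b₁) _ _ (begin
    b₁ + b₂ ℕ.* f ℕ.* b₁                      ≡⟨⟩
    (1 + b₂ ℕ.* f) ℕ.* b₁                     ≡⟨ cong (ℕ._* b₁) (det M) ⟨
    e ℕ.* d₂ ℕ.* b₁                           ≡⟨ ℕ.*-assoc e d₂ b₁ ⟩
    e ℕ.* (d₂ ℕ.* b₁)                         ≡⟨ cong (e ℕ.*_) eqD ⟩
    e ℕ.* (d₁ ℕ.* b₂ + D)                     ≡⟨ solve (e ∷ d₁ ∷ b₂ ∷ D ∷ []) ⟩
    b₂ ℕ.* (d₁ ℕ.* e) + D ℕ.* e               ≡⟨ cong (λ z → b₂ ℕ.* z + D ℕ.* e) eqx ⟩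
    b₂ ℕ.* (f ℕ.* b₁ + x) + D ℕ.* e           ≡⟨ solve (e ∷ f ∷ b₁ ∷ b₂ ∷ x ∷ D ∷ []) ⟩
    x ℕ.* b₂ + D ℕ.* e + b₂ ℕ.* f ℕ.* b₁      ∎)
  where open ≡-Reasoning

common-factor≡1 : ∀ {m n D u v} → Coprime m n → m ≡ D ℕ.* u → n ≡ D ℕ.* v → D ≡ 1
common-factor≡1 {D = D} {u} {v} c refl refl = c (m∣m*n u , m∣m*n v)

-- The two inequality hypotheses put f/e at or below d₁/b₁, and p/q at or
-- above d₂/b₂.
neighbours⇒unimodular : ∀ {d₁ b₁ d₂ b₂ e f p q D} →
  Coprime d₁ b₁ → Coprime d₂ b₂ → 1 ≤ p → 1 ≤ D →
  Det₁ e b₂ f d₂ → f ℕ.* b₁ ≤ d₁ ℕ.* e →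
  Det₁ b₁ q d₁ p → d₂ ℕ.* q ≤ p ℕ.* b₂ →
  d₂ ℕ.* b₁ ≡ d₁ ℕ.* b₂ + D → D ≡ 1
neighbours⇒unimodular {d₁} {b₁} {d₂} {b₂} {e} {f} {p} {q} {D} c₁ c₂ 1≤p 1≤D L l≤ R ≤r eqD
  with x , eqx ← ℕ.m≤n⇒∃[o]m+o≡n l≤ | y , eqy ← ℕ.m≤n⇒∃[o]m+o≡n ≤r
  with d₁≡ , b₁≡ ← cramer {d₁} {D = D} L (sym eqx) eqD
  -- The mirror image: exchanging numerators with denominators reverses the order of fractions, so
  -- the same rule expands `(b₂ , d₂)` in `(b₁ , d₁)` and `(q , p)`.
  with b₂≡ , d₂≡ ← cramer {b₂} {d₂} {b₁} {d₁} {p} {q} {y} {D}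
         (mkDet₁ (trans (ℕ.*-comm p b₁) (trans (det R) (cong suc (ℕ.*-comm q d₁)))))
         (trans (ℕ.*-comm b₂ p) (trans (sym eqy) (cong (ℕ._+ y) (ℕ.*-comm d₂ q))))
         (trans (ℕ.*-comm b₁ d₂) (trans eqD (cong (ℕ._+ D) (ℕ.*-comm d₁ b₂))))
  with x | y
-- A vanishing `x` means that f/e equals d₁/b₁, and a vanishing `y` that p/q equals d₂/b₂; then `D`
-- divides both members of a coprime pair.
... | zero  | _     = common-factor≡1 c₁ d₁≡ b₁≡
... | suc _ | zero  = common-factor≡1 c₂ d₂≡ b₂≡
... | suc x | suc y = contradiction d₁<d₂ (ℕ.≤⇒≯ d₂≤d₁)
  where
  open ℕ.≤-Reasoning
  d₂≤d₁ : d₂ ≤ d₁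
  d₂≤d₁ = begin
    d₂                            ≤⟨ ℕ.m≤m+n d₂ _ ⟩
    suc x ℕ.* d₂                  ≤⟨ ℕ.m≤m+n _ _ ⟩
    suc x ℕ.* d₂ + D ℕ.* f        ≡⟨ d₁≡ ⟨
    d₁                            ∎
  d₁<d₂ : d₁ < d₂
  d₁<d₂ = begin-strict
    d₁                            ≤⟨ ℕ.m≤m+n d₁ _ ⟩
    suc y ℕ.* d₁                  <⟨ ℕ.m<m+n _ (ℕ.*-mono-≤ 1≤D 1≤p) ⟩
    suc y ℕ.* d₁ + D ℕ.* p        ≡⟨ d₂≡ ⟨
    d₂                            ∎

-- Passage between rationals and pairs of naturals.

record Represents (γ : ℚ) (d b : ℕ) : Set where
  constructor mkRepresents
  field
    numerator   : ↥ γ ≡ + d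
    denominator : ↧ γ ≡ + b

open Represents

cross : ∀ {γ δ d b d′ b′} → Represents γ d b → Represents δ d′ b′ →
        ↥ γ * ↧ δ ≡ + (d ℕ.* b′)
cross {d = d} {b′ = b′} r s =
  trans (cong₂ _*_ (numerator r) (denominator s)) (sym (ℤ.pos-* d b′))

represents-< : ∀ {γ δ d b d′ b′} → Represents γ d b → Represents δ d′ b′ →
               d ℕ.* b′ < d′ ℕ.* b → γ ℚ.< δ
represents-< r s lt = ℚ.*<* (subst₂ ℤ._<_ (sym (cross r s)) (sym (cross s r)) (ℤ.+<+ lt))

represents-<⁻¹ : ∀ {γ δ d b d′ b′} → Represents γ d b → Represents δ d′ b′ →
                 γ ℚ.< δ → d ℕ.* b′ < d′ ℕ.* b
represents-<⁻¹ r s lt =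
  ℤ.drop‿+<+ (subst₂ ℤ._<_ (cross r s) (cross s r) (ℚ.drop-*<* lt))

-- Coprimality means that normalisation cancels nothing.
quotient-represents : ∀ {d b} .{{_ : ℕ.NonZero b}} → Coprime d b → Represents (+ d ℚ./ b) d b
quotient-represents {d} {suc b} c = mkRepresents (cong ↥_ eq) (cong ↧_ eq)
  where
  eq : + d ℚ./ suc b ≡ ℚ.mkℚ (+ d) b c
  eq = ℚ.normalize-coprime c

-- Passage between integer and natural matrices.

+[m+n]-+n≡+m : ∀ m n → + (m + n) - + n ≡ + m
+[m+n]-+n≡+m m n = trans (ℤ.m-n≡m⊖n (m + n) n)
  (trans (ℤ.⊖-≥ (ℕ.m≤n+m n m)) (cong +_ (ℕ.m+n∸n≡m m n)))

det-pos : ∀ {a b c d} → Det₁ a b c d → + a * + d - + b * + c ≡ 1ℤ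
det-pos {a} {b} {c} {d} M
  rewrite sym (ℤ.pos-* a d) | sym (ℤ.pos-* b c) | det M = +[m+n]-+n≡+m 1 (b ℕ.* c)

det-pos⁻¹ : ∀ {a b c d} → + a * + d - + b * + c ≡ 1ℤ → Det₁ a b c d
det-pos⁻¹ {a} {b} {c} {d} eq = mkDet₁ (ℤ.+-injective (begin
  + (a ℕ.* d)                                         ≡⟨ ℤ.pos-* a d ⟩
  + a * + d                                           ≡⟨ ℤ.+-identityʳ _ ⟨
  + a * + d ℤ.+ ℤ.0ℤ                                  ≡⟨ cong (λ z → + a * + d ℤ.+ z) (ℤ.+-inverseˡ (+ b * + c)) ⟨
  + a * + d ℤ.+ (ℤ.- (+ b * + c) ℤ.+ + b * + c)       ≡⟨ ℤ.+-assoc (+ a * + d) _ _ ⟨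
  + a * + d - + b * + c ℤ.+ + b * + c                 ≡⟨ cong₂ ℤ._+_ eq (sym (ℤ.pos-* b c)) ⟩
  + (1 + b ℕ.* c)                                     ∎))
  where open ≡-Reasoning

det₁-add : ∀ {e b f d} → Det₁ e b f d → Det₁ (e + b) b (f + d) d
det₁-add {e} {b} {f} {d} M = mkDet₁ (begin
  (e + b) ℕ.* d                  ≡⟨ ℕ.*-distribʳ-+ d e b ⟩
  e ℕ.* d + b ℕ.* d              ≡⟨ cong (ℕ._+ b ℕ.* d) (det M) ⟩
  1 + b ℕ.* f + b ℕ.* d          ≡⟨ cong suc (ℕ.*-distribˡ-+ b f d) ⟨
  1 + b ℕ.* (f + d)              ∎)
  where open ≡-Reasoning

det₁-sub : ∀ {e b f d} → Det₁ (e + b) b (f + d) d → Det₁ e b f d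
det₁-sub {e} {b} {f} {d} M = mkDet₁ (ℕ.+-cancelʳ-≡ (b ℕ.* d) _ _ (begin
  e ℕ.* d + b ℕ.* d              ≡⟨ ℕ.*-distribʳ-+ d e b ⟨
  (e + b) ℕ.* d                  ≡⟨ det M ⟩
  1 + b ℕ.* (f + d)              ≡⟨ cong suc (ℕ.*-distribˡ-+ b f d) ⟩
  1 + b ℕ.* f + b ℕ.* d          ∎))
  where open ≡-Reasoning

member⇒saturated : ∀ {Q d b} → Member Q d b →
                   ∃ λ γ → γ ∈ SaturatedFarey Q × Represents γ d b
member⇒saturated {Q} {d} {b} m =
  d/b N N∈𝒮 , (N , (N∈𝒮 , trace≤Q) , refl) ,
  quotient-represents {{b-nonZero N∈𝒮}} (member⇒coprime m)
  where
  open Member m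
  N : SL₂ℤ
  N = mkSL₂ℤ (+ (e + b)) (+ b) (+ (f + d)) (+ d) (det-pos (det₁-add matrix))
  N∈𝒮 : N ∈ 𝒮
  N∈𝒮 = mk𝒮 (ℤ.+≤+ (ℕ.m≤n+m b e)) (ℤ.+≤+ d≤b) (ℤ.+≤+ 1≤d)
             (ℤ.+≤+ (ℕ.+-mono-≤ (ℕ.<⇒≤ (d≤b⇒f<e matrix d≤b)) d≤b)) (ℤ.+≤+ (ℕ.m≤n+m d f))

det₁⇒member : ∀ {Q a b c d} → Det₁ a b c d → 1 ≤ d → d ≤ b → b ≤ a → d ≤ c →
              + (a + d) ℤ.≤ Q → Member Q d b
det₁⇒member {Q} {a} {b} {c} {d} M 1≤d d≤b b≤a d≤c tr =
  mkMember (a ℕ.∸ b) (c ℕ.∸ d) (det₁-sub (subst₂ (λ a c → Det₁ a b c d) a≡ c≡ M)) 1≤d d≤b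
    (subst (λ a → + (a + d) ℤ.≤ Q) a≡ tr)
  where
  a≡ : a ≡ a ℕ.∸ b + b
  a≡ = sym (ℕ.m∸n+n≡m b≤a)
  c≡ : c ≡ c ℕ.∸ d + d
  c≡ = sym (ℕ.m∸n+n≡m d≤c)

saturated⇒member : ∀ {Q γ} → γ ∈ SaturatedFarey Q → ∃₂ λ d b → Represents γ d b × Member Q d b
saturated⇒member {Q} (mkSL₂ℤ a b c d det≡1 , (M∈𝒮@(mk𝒮 a≥b b≥d d≥1 _ c≥d) , tr) , refl) =
  go d≥1 b≥d a≥b c≥d det≡1 tr {{b-nonZero M∈𝒮}}
  where
  go : ∀ {a b c d} → 1ℤ ℤ.≤ d → d ℤ.≤ b → b ℤ.≤ a → d ℤ.≤ c →
       a * d - b * c ≡ 1ℤ → a ℤ.+ d ℤ.≤ Q → .{{_ : ℤ.NonZero b}} →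
       ∃₂ λ d′ b′ → Represents (d ℚ./ ℤ.∣ b ∣) d′ b′ × Member Q d′ b′
  -- The chain 1 ≤ `d` ≤ `b` ≤ `a` together with `d` ≤ `c` rules out negative entries.
  go {+ a} {+ b} {+ c} {+ d} (ℤ.+≤+ 1≤d) (ℤ.+≤+ d≤b) (ℤ.+≤+ b≤a) (ℤ.+≤+ d≤c) eq tr =
    d , b , quotient-represents (member⇒coprime m) , m
    where m = det₁⇒member (det-pos⁻¹ eq) 1≤d d≤b b≤a d≤c tr

-- Consecutive elements.

unimodular-ℤ : ∀ {γ₁ γ₂ d₁ b₁ d₂ b₂} → Represents γ₁ d₁ b₁ → Represents γ₂ d₂ b₂ →
                  d₂ ℕ.* b₁ ≡ d₁ ℕ.* b₂ + 1 → ↥ γ₂ * ↧ γ₁ - ↥ γ₁ * ↧ γ₂ ≡ 1ℤ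
unimodular-ℤ {d₁ = d₁} {b₂ = b₂} r₁ r₂ eq
  rewrite cross r₂ r₁ | cross r₁ r₂ | eq | ℕ.+-comm (d₁ ℕ.* b₂) 1 = +[m+n]-+n≡+m 1 (d₁ ℕ.* b₂)

0-represents : Represents ℚ.0ℚ 0 1
0-represents = mkRepresents refl refl

saturated*⇒represents : ∀ {Q γ} → γ ∈ SaturatedFarey* Q →
  ∃₂ λ d b → Represents γ d b × ((d ≡ 0 × b ≡ 1) ⊎ Member Q d b)
saturated*⇒represents (inj₁ refl) = 0 , 1 , 0-represents , inj₁ (refl , refl)
saturated*⇒represents (inj₂ γ∈) with d , b , r , m ← saturated⇒member γ∈ = d , b , r , inj₂ m

propositionA2 : ∀ (Q : ℤ) → Q ≥ + 3 → ∀ (γ₁ γ₂ : ℚ) → Consecutive (SaturatedFarey* Q) γ₁ γ₂ →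
    (↥ γ₂) * (↧ γ₁) - (↥ γ₁) * (↧ γ₂) ≡ 1ℤ
propositionA2 Q _ γ₁ γ₂ (mkConsecutive γ₁∈ γ₂∈ γ₁<γ₂ nothing-between)
  with saturated*⇒represents γ₁∈ | saturated*⇒represents γ₂∈
... | d₁ , b₁ , r₁ , m₁ | _ , _ , r₂ , inj₁ (refl , refl) =
  -- Every element has a natural numerator, so none lies below `γ₂` = 0.
  contradiction (represents-<⁻¹ r₁ r₂ γ₁<γ₂) ℕ.n≮0
... | d₁ , b₁ , r₁ , m₁ | d₂ , b₂ , r₂ , inj₂ m₂
  with e , f , L , f≡0⊎l ← left-parent m₂
  with D , eqD ← ℕ.m≤n⇒∃[o]m+o≡n (ℕ.<⇒≤ (represents-<⁻¹ r₁ r₂ γ₁<γ₂))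
  = unimodular-ℤ r₁ r₂ (trans (sym eqD) (cong (λ z → d₁ ℕ.* b₂ + z) (D≡1 m₁)))
  where
  lt : d₁ ℕ.* b₂ < d₂ ℕ.* b₁
  lt = represents-<⁻¹ r₁ r₂ γ₁<γ₂

  no-member-between : ∀ {p q} → Member Q p q → d₁ ℕ.* q < p ℕ.* b₁ → d₂ ℕ.* q ≤ p ℕ.* b₂
  no-member-between m γ₁<p/q with γ , γ∈ , r ← member⇒saturated m =
    ℕ.≮⇒≥ λ p/q<γ₂ → nothing-between γ (inj₂ γ∈)
      (represents-< r₁ r γ₁<p/q , represents-< r r₂ p/q<γ₂)

  1≤D : 1 ≤ D
  1≤D = ℕ.+-cancelˡ-< (d₁ ℕ.* b₂) 0 D
    (subst₂ _<_ (sym (ℕ.+-identityʳ _)) (sym eqD) lt)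

  left≤γ₁ : f ≡ 0 ⊎ Member Q f e → f ℕ.* b₁ ≤ d₁ ℕ.* e
  left≤γ₁ (inj₁ refl) = z≤n
  -- Since f/e lies strictly below `γ₂`, lying above `γ₁` would put it strictly between.
  left≤γ₁ (inj₂ l) = ℕ.≮⇒≥ λ γ₁<l → contradiction
    (no-member-between l γ₁<l)
    (ℕ.<⇒≱ (subst₂ _<_ (ℕ.*-comm b₂ f) (ℕ.*-comm e d₂) (det₁⇒< L)))

  -- Needed for `γ₁` to have a right parent in the set.
  γ₁<1 : d₁ < b₁
  γ₁<1 = ℕ.*-cancelʳ-< b₂ d₁ b₁ (begin-strict
    d₁ ℕ.* b₂  <⟨ lt ⟩
    d₂ ℕ.* b₁  ≤⟨ ℕ.*-monoˡ-≤ b₁ (Member.d≤b m₂) ⟩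
    b₂ ℕ.* b₁  ≡⟨ ℕ.*-comm b₂ b₁ ⟩
    b₁ ℕ.* b₂  ∎)
    where open ℕ.≤-Reasoning

  D≡1 : (d₁ ≡ 0 × b₁ ≡ 1) ⊎ Member Q d₁ b₁ → D ≡ 1
  D≡1 (inj₁ (refl , refl))
    -- For `γ₁` = 0/1 the left parent of `γ₂` must be 0, so `e * d₂` = 1 and the numerator `d₂`,
    -- which here equals `D`, is 1.
    with refl ← ℕ.n≤0⇒n≡0 (subst (_≤ 0) (ℕ.*-identityʳ f) (left≤γ₁ f≡0⊎l)) =
    trans eqD (trans (ℕ.*-identityʳ d₂)
      (ℕ.m*n≡1⇒n≡1 e d₂ (trans (det L) (cong suc (ℕ.*-zeroʳ b₂)))))
  D≡1 (inj₂ m) with p , q , R , r ← right-parent m γ₁<1 =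
    neighbours⇒unimodular (member⇒coprime m) (member⇒coprime m₂) (Member.1≤d r) 1≤D
      L (left≤γ₁ f≡0⊎l) R
      (no-member-between r (subst₂ _<_ (ℕ.*-comm q d₁) (ℕ.*-comm b₁ p) (det₁⇒< R)))
      (sym eqD)
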